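{- Let $p$ be an odd prime, $f(x)\in\mathbb{Z}[x]$, $n\ge1$, and let $\sigma$ be a cycle of $f_n$ of length $k$ which partially splits, with $d$ the order of $a_n$ in $(\mathbb{Z}/p\mathbb{Z})^*$ (so $1<d<p$). Let $\tilde\sigma$ be a lift of $\sigma$ of length $kd$, let $y$ be an integer whose class mod $p^{n+1}$ is an element of $\tilde\sigma$, let $h=f^{kd}$ be the $kd$-th iterate of $f$, let $a_{n+1}=h'(y)$, and let $e=\mathrm{ord}_p(a_{n+1}-1)$. (1) If $e<nd$, then $\tilde\sigma$ splits $e-1$ times, and then its descendants at level $n+e$ grow. (2) If $e\ge nd$, then $\tilde\sigma$ splits $nd-1$ times. Moreover, if $e<n$, then every lift of $\sigma$ of length $kd$ has the same value of $e$.
   Context: $f_n:\mathbb{Z}/p^n\mathbb{Z}\to\mathbb{Z}/p^n\mathbb{Z}$ is the map $x\mapsto f(x)\bmod p^n$; a cycle of $f_n$ is said to be at level $n$. Let $\sigma=(x_1,\dots,x_k)$ be a cycle of $f_n$ of length $k$ (distinct elements, $f_n(x_i)=x_{i+1}$, $f_n(x_k)=x_1$), with the $x_i$ viewed as integers representing their classes. Put $g=f^k$ ($k$-th iterate), $a_n=g'(x_1)$, $b_n=(g(x_1)-x_1)/p^n$. A lift of $\sigma$ is a cycle of $f_{n+1}$ all of whose elements reduce mod $p^n$ to elements of $\sigma$. The cycle $\sigma$: grows if $a_n\equiv1$ and $b_n\not\equiv0\pmod p$ (then it has a single lift, of length $pk$); splits if $a_n\equiv1$ and $b_n\equiv0\pmod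 p$ (then it has $p$ lifts, each of length $k$); partially splits if $a_n\not\equiv0,1\pmod p$ (then, with $d$ the order of $a_n$ in $(\mathbb{Z}/p\mathbb{Z})^*$, it has one lift of length $k$ and $(p-1)/d$ lifts of length $kd$). These conditions are independent of the choices. The same terms apply at every level. The descendants of a cycle $\tau$ at level $N$ are $\tau$ itself (at level $N$), its lifts (at level $N+1$), the lifts of those (at level $N+2$), and so on. A cycle $\tau$ at level $N$ "splits $s$ times" if all its descendants at levels $N,N+1,\dots,N+s-1$ split (no condition if $s=0$). $\mathrm{ord}_p$ is the $p$-adic valuation, with $\mathrm{ord}_p(0)=\infty$. -}

module Defs where

open import Data.Nat as ℕ using (ℕ; zero; suc; NonZero; _^_)
open import Data.Nat.DivMod using (_mod_)
open import Data.Nat.Primality using (Prime; prime⇒nonZero)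
open import Data.Nat.Properties using (m^n≢0)
open import Data.Integer as ℤ using (ℤ; +_; 0ℤ; 1ℤ; _+_; _*_; _-_; ∣_∣; _/ℕ_)
open import Data.Integer.Divisibility.Signed using (_∣_; _∣?_)
open import Data.Fin using (Fin; toℕ)
open import Data.List using (List; []; _∷_; map)
open import Data.Product using (_×_; ∃)
open import Relation.Nullary using (¬_; yes; no)
open import Relation.Nullary.Construct.Add.Supremum using (_⁺; ⊤⁺; [_])
open import Relation.Unary using (Decidable)
open import Relation.Binary.PropositionalEquality using (_≡_)

-- Polynomials are lists of coefficients, constant term first; trailing zeros
-- are allowed.

ℤ[X] : Set
ℤ[X] = List ℤ

X : ℤ[X]
X = 0ℤ ∷ 1ℤ ∷ []

infixl 6 _⊕_
infixl 7 _⊛_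

_⊕_ : ℤ[X] → ℤ[X] → ℤ[X]
[]       ⊕ q        = q
p        ⊕ []       = p
(a ∷ p)  ⊕ (b ∷ q)  = (a + b) ∷ (p ⊕ q)

_⊛_ : ℤ[X] → ℤ[X] → ℤ[X]
[]      ⊛ q = []
(a ∷ p) ⊛ q = map (a *_) q ⊕ (0ℤ ∷ (p ⊛ q))

compose : ℤ[X] → ℤ[X] → ℤ[X]
compose []      q = []
compose (a ∷ p) q = (a ∷ []) ⊕ (q ⊛ compose p q)

-- The k-th iterate as a polynomial, so that it has a derivative.
iterate : ℤ[X] → ℕ → ℤ[X]
iterate f zero    = X
iterate f (suc k) = compose f (iterate f k)

eval : ℤ[X] → ℤ → ℤ
eval []      x = 0ℤ
eval (a ∷ p) x = a + x * eval p x

-- scaleFrom i (a₀ ∷ a₁ ∷ …) = (i a₀ ∷ (i+1) a₁ ∷ …)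
scaleFrom : ℕ → ℤ[X] → ℤ[X]
scaleFrom i []      = []
scaleFrom i (a ∷ p) = (+ i * a) ∷ scaleFrom (suc i) p

derivative : ℤ[X] → ℤ[X]
derivative []      = []
derivative (a ∷ p) = scaleFrom 1 p

infix 4 _≡_[mod_]

_≡_[mod_] : ℤ → ℤ → ℕ → Set
a ≡ b [mod m ] = + m ∣ a - b

record IsOrderMod (p : ℕ) (a : ℤ) (d : ℕ) : Set where
  field
    positive : 0 ℕ.< d
    power≡1  : a ℤ.^ d ≡ 1ℤ [mod p ]
    minimal  : ∀ j → 0 ℕ.< j → a ℤ.^ j ≡ 1ℤ [mod p ] → d ℕ.≤ j

-- The greatest e ≤ b satisfying P, or 0 if there is none.
greatest≤ : {P : ℕ → Set} → Decidable P → ℕ → ℕ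
greatest≤ P? zero = zero
greatest≤ P? (suc b) with P? (suc b)
... | yes _ = suc b
... | no  _ = greatest≤ P? b

-- The p-adic valuation, for p ≥ 2.  The search bound loses nothing: if
-- z ≠ 0 and p ^ e divides z, then e < p ^ e ≤ ∣ z ∣.
ord : ℕ → ℤ → ℕ ⁺
ord p z with z ℤ.≟ 0ℤ
... | yes _ = ⊤⁺
... | no  _ = [ greatest≤ (λ e → + (p ^ e) ∣? z) ∣ z ∣ ]

module Dynamics (p : ℕ) (p-prime : Prime p) (f : ℤ[X]) where

  -- A cycle of fₙ, with the elements of ℤ/pⁿℤ given by integer
  -- representatives: points i stands for x_{i+1}.
  record Cycle (n : ℕ) : Set where
    field
      length       : ℕ
      {{length≢0}} : NonZero length
      points       : Fin length → ℤ
      distinct     : ∀ i j → points i ≡ points j [mod p ^ n ] → i ≡ j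
      step         : ∀ i → eval f (points i) ≡ points (suc (toℕ i) mod length) [mod p ^ n ]

    x₁ : ℤ
    x₁ = points (0 mod length)

  open Cycle public using (length)
  open Cycle using (points; x₁)

  infix 4 _∈ᶜ_

  _∈ᶜ_ : ∀ {n} → ℤ → Cycle n → Set
  _∈ᶜ_ {n} y σ = ∃ λ i → y ≡ points σ i [mod p ^ n ]

  IsLift : ∀ {n} → Cycle n → Cycle (suc n) → Set
  IsLift σ τ = ∀ i → points τ i ∈ᶜ σ

  a : ∀ {n} → Cycle n → ℤ
  a σ = eval (derivative (iterate f (length σ))) (x₁ σ)

  -- The division is exact, as σ is a cycle of fₙ.
  b : ∀ {n} → Cycle n → ℤ
  b {n} σ = (eval (iterate f (length σ)) (x₁ σ) - x₁ σ) /ℕ (p ^ n)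
    where
    instance
      pⁿ≢0 : NonZero (p ^ n)
      pⁿ≢0 = m^n≢0 p n {{prime⇒nonZero p-prime}}

  Grows : ∀ {n} → Cycle n → Set
  Grows σ = a σ ≡ 1ℤ [mod p ] × ¬ b σ ≡ 0ℤ [mod p ]

  Splits : ∀ {n} → Cycle n → Set
  Splits σ = a σ ≡ 1ℤ [mod p ] × b σ ≡ 0ℤ [mod p ]

  PartiallySplits : ∀ {n} → Cycle n → Set
  PartiallySplits σ = ¬ a σ ≡ 0ℤ [mod p ] × ¬ a σ ≡ 1ℤ [mod p ]

  data Descendant {N : ℕ} (τ : Cycle N) : {M : ℕ} → Cycle M → Set where
    self : Descendant τ τ
    lift : ∀ {M} {ρ : Cycle M} {ρ′ : Cycle (suc M)} →
           Descendant τ ρ → IsLift ρ ρ′ → Descendant τ ρ′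

  SplitsTimes : ∀ {N} → ℕ → Cycle N → Set
  SplitsTimes {N} s τ = ∀ {M} (ρ : Cycle M) → Descendant τ ρ → M ℕ.< N ℕ.+ s → Splits ρ

{-# OPTIONS --safe #-}

-- Write g = fᵏ and h = gᵈ, so that h(x) - x = Q(x)(g(x) - x) with Q ∈ ℤ[X].  At a
-- point w of the lift, g(w) - w is exactly divisible by pⁿ and g′(w) - 1 is a
-- unit, and
--   h′(w) - 1 = Q′(w)(g(w) - w) + Q(w)(g′(w) - 1).
-- As h commutes with g, Q(g(w)) ≡ Q(w) modulo pⁿQ(w), so Q is nearly constant on
-- the d points gⁱ(w), which agree mod pⁿ and are distinct mod pⁿ⁺¹.  Newton
-- interpolation at these points shows that Q is nearly constant on w + pⁿℤ and
-- that pⁿQ′(w) is negligible, both up to an error pⁿᵈ.  Hence for m ≤ nd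
--   pᵐ ∣ h′(w) - 1  ⇔  pᵐ ∣ Q(w)  ⇔  pⁿ⁺ᵐ ∣ h(w) - w,
-- and the last condition is the same for all points that reduce into the lift.

module Submission where

open import Defs
open import Data.Nat using (ℕ; zero; suc; _+_; _*_; _∸_; _^_; _≤_; _<_; z≤n; s≤s; _%_; _/_)
import Data.Nat as ℕ
import Data.Nat.Properties as ℕₚ
import Data.Nat.Divisibility as ℕ∣
open import Data.Nat.DivMod using (_mod_; m<n⇒m%n≡m; m%n<n; m%n%n≡m%n; %-distribˡ-+; [m+kn]%n≡m%n; m≡m%n+[m/n]*n)
open import Data.Nat.Primality using (Prime; prime⇒nonZero; prime⇒nonTrivial; euclidsLemma)
open import Data.Integer using (ℤ; +_; 0ℤ; 1ℤ; _-_; -_; _/ℕ_; _%ℕ_) renaming (_+_ to _+ᶻ_; _*_ to _*ᶻ_)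
import Data.Integer as ℤ
import Data.Integer.Properties as ℤₚ
open import Data.Integer.DivMod using (a≡a%ℕn+[a/ℕn]*n; n%ℕd<d)
open import Data.Integer.Divisibility.Signed
open import Data.Integer.Tactic.RingSolver using (solve)
open import Data.Fin using (Fin; toℕ)
open import Data.Fin.Properties using (toℕ-injective; toℕ-fromℕ<; fromℕ<-cong; toℕ<n)
open import Data.List using ([]; _∷_; map)
open import Data.Product using (∃; _×_; _,_; proj₁; proj₂)
open import Data.Sum using (_⊎_; inj₁; inj₂; [_,_]′) renaming (map to ⊎-map)
open import Relation.Nullary using (¬_; contradiction; yes; no)
open import Relation.Nullary.Construct.Add.Supremum using (_⁺; [_])
open import Relation.Unary using (Decidable)
open import Relation.Binary.Construct.Add.Supremum.NonStrict _≤_ as ≤⁺ using (_≤⁺_)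
open import Relation.Binary.Construct.Add.Supremum.Strict _<_ as <⁺ using (_<⁺_)
open import Relation.Binary.PropositionalEquality

-- Polynomial functions

eval-⊕ : ∀ P Q x → eval (P ⊕ Q) x ≡ eval P x +ᶻ eval Q x
eval-⊕ []      Q       x = sym (ℤₚ.+-identityˡ _)
eval-⊕ (a ∷ P) []      x = sym (ℤₚ.+-identityʳ _)
eval-⊕ (a ∷ P) (b ∷ Q) x = trans (cong (λ v → a +ᶻ b +ᶻ x *ᶻ v) (eval-⊕ P Q x)) (shuffle (eval P x) (eval Q x))
  where
  shuffle : ∀ u v → a +ᶻ b +ᶻ x *ᶻ (u +ᶻ v) ≡ (a +ᶻ x *ᶻ u) +ᶻ (b +ᶻ x *ᶻ v)
  shuffle u v = solve (a ∷ b ∷ x ∷ u ∷ v ∷ [])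

eval-map-* : ∀ c P x → eval (map (c *ᶻ_) P) x ≡ c *ᶻ eval P x
eval-map-* c []      x = sym (ℤₚ.*-zeroʳ c)
eval-map-* c (a ∷ P) x = trans (cong (λ v → c *ᶻ a +ᶻ x *ᶻ v) (eval-map-* c P x)) (shuffle (eval P x))
  where
  shuffle : ∀ u → c *ᶻ a +ᶻ x *ᶻ (c *ᶻ u) ≡ c *ᶻ (a +ᶻ x *ᶻ u)
  shuffle u = solve (a ∷ c ∷ x ∷ u ∷ [])

eval-⊛ : ∀ P Q x → eval (P ⊛ Q) x ≡ eval P x *ᶻ eval Q x
eval-⊛ []      Q x = sym (ℤₚ.*-zeroˡ (eval Q x))
eval-⊛ (a ∷ P) Q x = begin
  eval (map (a *ᶻ_) Q ⊕ (0ℤ ∷ (P ⊛ Q))) x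
    ≡⟨ eval-⊕ (map (a *ᶻ_) Q) _ x ⟩
  eval (map (a *ᶻ_) Q) x +ᶻ (0ℤ +ᶻ x *ᶻ eval (P ⊛ Q) x)
    ≡⟨ cong₂ (λ u v → u +ᶻ (0ℤ +ᶻ x *ᶻ v)) (eval-map-* a Q x) (eval-⊛ P Q x) ⟩
  a *ᶻ eval Q x +ᶻ (0ℤ +ᶻ x *ᶻ (eval P x *ᶻ eval Q x))
    ≡⟨ shuffle (eval P x) (eval Q x) ⟩
  (a +ᶻ x *ᶻ eval P x) *ᶻ eval Q x ∎
  where
  open ≡-Reasoning
  shuffle : ∀ u v → a *ᶻ v +ᶻ (0ℤ +ᶻ x *ᶻ (u *ᶻ v)) ≡ (a +ᶻ x *ᶻ u) *ᶻ v
  shuffle u v = solve (a ∷ x ∷ u ∷ v ∷ [])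

eval-const : ∀ c x → eval (c ∷ []) x ≡ c
eval-const c x = trans (cong (c +ᶻ_) (ℤₚ.*-zeroʳ x)) (ℤₚ.+-identityʳ c)

eval-X : ∀ x → eval X x ≡ x
eval-X x = trans (ℤₚ.+-identityˡ _) (trans (cong (x *ᶻ_) (eval-const 1ℤ x)) (ℤₚ.*-identityʳ x))

eval-compose : ∀ P Q x → eval (compose P Q) x ≡ eval P (eval Q x)
eval-compose []      Q x = refl
eval-compose (a ∷ P) Q x = trans (eval-⊕ (a ∷ []) (Q ⊛ compose P Q) x)
  (cong₂ _+ᶻ_ (eval-const a x)
    (trans (eval-⊛ Q (compose P Q) x) (cong (eval Q x *ᶻ_) (eval-compose P Q x))))

-- Product rule for `x^i P(x)` with the common factor `x^(i-1)` removed. General `i` is needed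
-- because the recursion of `scaleFrom` raises it; `i = 1` then gives the derivative of
-- `a + x P(x)`.
eval-scaleFrom : ∀ i P x →
  eval (scaleFrom i P) x ≡ + i *ᶻ eval P x +ᶻ x *ᶻ eval (derivative P) x
eval-scaleFrom i []      x = sym (cong₂ _+ᶻ_ (ℤₚ.*-zeroʳ (+ i)) (ℤₚ.*-zeroʳ x))
eval-scaleFrom i (a ∷ P) x = begin
  + i *ᶻ a +ᶻ x *ᶻ eval (scaleFrom (suc i) P) x
    ≡⟨ cong (λ v → + i *ᶻ a +ᶻ x *ᶻ v) (eval-scaleFrom (suc i) P x) ⟩
  + i *ᶻ a +ᶻ x *ᶻ ((1ℤ +ᶻ + i) *ᶻ eval P x +ᶻ x *ᶻ eval (derivative P) x)
    ≡⟨ shuffle (+ i) (eval P x) (eval (derivative P) x) ⟩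
  + i *ᶻ (a +ᶻ x *ᶻ eval P x) +ᶻ x *ᶻ (1ℤ *ᶻ eval P x +ᶻ x *ᶻ eval (derivative P) x)
    ≡⟨ cong (λ v → + i *ᶻ (a +ᶻ x *ᶻ eval P x) +ᶻ x *ᶻ v) (eval-scaleFrom 1 P x) ⟨
  + i *ᶻ (a +ᶻ x *ᶻ eval P x) +ᶻ x *ᶻ eval (scaleFrom 1 P) x ∎
  where
  open ≡-Reasoning
  shuffle : ∀ j u v → j *ᶻ a +ᶻ x *ᶻ ((1ℤ +ᶻ j) *ᶻ u +ᶻ x *ᶻ v)
                    ≡ j *ᶻ (a +ᶻ x *ᶻ u) +ᶻ x *ᶻ (1ℤ *ᶻ u +ᶻ x *ᶻ v)
  shuffle j u v = solve (a ∷ x ∷ j ∷ u ∷ v ∷ [])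

x-y∣P[x]-P[y] : ∀ P x y → x - y ∣ eval P x - eval P y
x-y∣P[x]-P[y] []      x y = divides 0ℤ refl
x-y∣P[x]-P[y] (a ∷ P) x y = subst (x - y ∣_) (shuffle (eval P x) (eval P y))
  (∣m∣n⇒∣m+n (∣n⇒∣m*n x (x-y∣P[x]-P[y] P x y)) (∣m⇒∣m*n (eval P y) ∣-refl))
  where
  shuffle : ∀ u v → x *ᶻ (u - v) +ᶻ (x - y) *ᶻ v ≡ (a +ᶻ x *ᶻ u) - (a +ᶻ y *ᶻ v)
  shuffle u v = solve (a ∷ x ∷ y ∷ u ∷ v ∷ [])

-- The divided difference `(P(U) - P(V)) / (U - V)`, built as a polynomial so that it can itself be
-- differentiated.
diffQuot : ℤ[X] → ℤ[X] → ℤ[X] → ℤ[X]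
diffQuot []      U V = []
diffQuot (a ∷ P) U V = compose P V ⊕ (U ⊛ diffQuot P U V)

eval-diffQuot : ∀ P U V x → eval P (eval U x) - eval P (eval V x)
                          ≡ (eval U x - eval V x) *ᶻ eval (diffQuot P U V) x
eval-diffQuot []      U V x = sym (ℤₚ.*-zeroʳ (eval U x - eval V x))
eval-diffQuot (a ∷ P) U V x = begin
  (a +ᶻ u *ᶻ pu) - (a +ᶻ v *ᶻ pv)
    ≡⟨ split u v pu pv ⟩
  u *ᶻ (pu - pv) +ᶻ (u - v) *ᶻ pv
    ≡⟨ cong (λ e → u *ᶻ e +ᶻ (u - v) *ᶻ pv) (eval-diffQuot P U V x) ⟩
  u *ᶻ ((u - v) *ᶻ q) +ᶻ (u - v) *ᶻ pv
    ≡⟨ collect u v pv q ⟩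
  (u - v) *ᶻ (pv +ᶻ u *ᶻ q)
    ≡⟨ cong ((u - v) *ᶻ_) (trans (eval-⊕ (compose P V) (U ⊛ diffQuot P U V) x)
         (cong₂ _+ᶻ_ (eval-compose P V x) (eval-⊛ U (diffQuot P U V) x))) ⟨
  (u - v) *ᶻ eval (diffQuot (a ∷ P) U V) x ∎
  where
  open ≡-Reasoning
  u = eval U x
  v = eval V x
  pu = eval P u
  pv = eval P v
  q = eval (diffQuot P U V) x
  split : ∀ u v pu pv → (a +ᶻ u *ᶻ pu) - (a +ᶻ v *ᶻ pv) ≡ u *ᶻ (pu - pv) +ᶻ (u - v) *ᶻ pv
  split u v pu pv = solve (a ∷ u ∷ v ∷ pu ∷ pv ∷ [])
  collect : ∀ u v pv q → u *ᶻ ((u - v) *ᶻ q) +ᶻ (u - v) *ᶻ pv ≡ (u - v) *ᶻ (pv +ᶻ u *ᶻ q)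
  collect u v pv q = solve (u ∷ v ∷ pv ∷ q ∷ [])

-- Depends on the function alone, not on a coefficient list, so that
-- identities between polynomial functions can be differentiated.
HasDerivative : (ℤ → ℤ) → ℤ → ℤ → Set
HasDerivative F x c = ∀ s → ∃ λ r → F (x +ᶻ s) ≡ F x +ᶻ s *ᶻ c +ᶻ s *ᶻ s *ᶻ r

hasDerivative-eval : ∀ P x → HasDerivative (eval P) x (eval (derivative P) x)
hasDerivative-eval []      x s = 0ℤ , solve (s ∷ [])
hasDerivative-eval (a ∷ P) x s with hasDerivative-eval P x s
... | r , eq = eval (derivative P) x +ᶻ x *ᶻ r +ᶻ s *ᶻ r , (begin
  a +ᶻ (x +ᶻ s) *ᶻ eval P (x +ᶻ s)
    ≡⟨ cong (λ v → a +ᶻ (x +ᶻ s) *ᶻ v) eq ⟩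
  a +ᶻ (x +ᶻ s) *ᶻ (eval P x +ᶻ s *ᶻ eval (derivative P) x +ᶻ s *ᶻ s *ᶻ r)
    ≡⟨ shuffle r (eval P x) (eval (derivative P) x) ⟩
  a +ᶻ x *ᶻ eval P x +ᶻ s *ᶻ (1ℤ *ᶻ eval P x +ᶻ x *ᶻ eval (derivative P) x)
    +ᶻ s *ᶻ s *ᶻ (eval (derivative P) x +ᶻ x *ᶻ r +ᶻ s *ᶻ r)
    ≡⟨ cong (λ v → a +ᶻ x *ᶻ eval P x +ᶻ s *ᶻ v +ᶻ s *ᶻ s *ᶻ (eval (derivative P) x +ᶻ x *ᶻ r +ᶻ s *ᶻ r))
         (eval-scaleFrom 1 P x) ⟨
  a +ᶻ x *ᶻ eval P x +ᶻ s *ᶻ eval (scaleFrom 1 P) x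
    +ᶻ s *ᶻ s *ᶻ (eval (derivative P) x +ᶻ x *ᶻ r +ᶻ s *ᶻ r) ∎)
  where
  open ≡-Reasoning
  shuffle : ∀ r u v → a +ᶻ (x +ᶻ s) *ᶻ (u +ᶻ s *ᶻ v +ᶻ s *ᶻ s *ᶻ r)
    ≡ a +ᶻ x *ᶻ u +ᶻ s *ᶻ (1ℤ *ᶻ u +ᶻ x *ᶻ v) +ᶻ s *ᶻ s *ᶻ (v +ᶻ x *ᶻ r +ᶻ s *ᶻ r)
  shuffle r u v = solve (a ∷ x ∷ s ∷ r ∷ u ∷ v ∷ [])

∣-small⇒≡0 : ∀ z → + suc ℤ.∣ z ∣ ∣ z → z ≡ 0ℤ
∣-small⇒≡0 z d with ℤ.∣ z ∣ in eq | ∣⇒∣ᵤ d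
... | zero  | _ = ℤₚ.∣i∣≡0⇒i≡0 eq
... | suc m | e with () ← ℕₚ.<⇒≱ (ℕₚ.n<1+n (suc m)) (ℕ∣.∣⇒≤ e)

-- A single increment replaces the limit. Comparing both expansions at `s` gives
-- `s (c - c′) = s² (r′ - r)`, so `s` divides `c - c′`; the choice `s = 1 + ∣c - c′∣` is too large
-- for a nonzero difference.
hasDerivative-unique : ∀ {F F′ x c c′} → F ≗ F′ →
  HasDerivative F x c → HasDerivative F′ x c′ → c ≡ c′
hasDerivative-unique {F} {F′} {x} {c} {c′} F≗F′ D D′ = ℤₚ.i-j≡0⇒i≡j c c′ (∣-small⇒≡0 (c - c′) (s∣ (D s) (D′ s)))
  where
  s = + suc ℤ.∣ c - c′ ∣
  s∣ : (∃ λ r → F (x +ᶻ s) ≡ F x +ᶻ s *ᶻ c +ᶻ s *ᶻ s *ᶻ r) →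
       (∃ λ r → F′ (x +ᶻ s) ≡ F′ x +ᶻ s *ᶻ c′ +ᶻ s *ᶻ s *ᶻ r) → s ∣ c - c′
  s∣ (r , eq) (r′ , eq′) = divides (r′ - r) (ℤₚ.*-cancelˡ-≡ s _ _ (begin
    s *ᶻ (c - c′)
      ≡⟨ shuffle s (F x) c c′ r r′ ⟩
    ((F x +ᶻ s *ᶻ c +ᶻ s *ᶻ s *ᶻ r) - (F x +ᶻ s *ᶻ c′ +ᶻ s *ᶻ s *ᶻ r′)) +ᶻ s *ᶻ ((r′ - r) *ᶻ s)
      ≡⟨ cong (_+ᶻ s *ᶻ ((r′ - r) *ᶻ s)) (ℤₚ.i≡j⇒i-j≡0 same) ⟩
    0ℤ +ᶻ s *ᶻ ((r′ - r) *ᶻ s)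
      ≡⟨ ℤₚ.+-identityˡ _ ⟩
    s *ᶻ ((r′ - r) *ᶻ s) ∎))
    where
    open ≡-Reasoning
    same : F x +ᶻ s *ᶻ c +ᶻ s *ᶻ s *ᶻ r ≡ F x +ᶻ s *ᶻ c′ +ᶻ s *ᶻ s *ᶻ r′
    same = trans (sym eq) (trans (F≗F′ (x +ᶻ s))
      (trans eq′ (cong (λ v → v +ᶻ s *ᶻ c′ +ᶻ s *ᶻ s *ᶻ r′) (sym (F≗F′ x)))))
    shuffle : ∀ s y c c′ r r′ → s *ᶻ (c - c′)
      ≡ ((y +ᶻ s *ᶻ c +ᶻ s *ᶻ s *ᶻ r) - (y +ᶻ s *ᶻ c′ +ᶻ s *ᶻ s *ᶻ r′)) +ᶻ s *ᶻ ((r′ - r) *ᶻ s)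
    shuffle s y c c′ r r′ = solve (s ∷ y ∷ c ∷ c′ ∷ r ∷ r′ ∷ [])

hasDerivative-cong : ∀ {F F′ x c} → F ≗ F′ → HasDerivative F x c → HasDerivative F′ x c
hasDerivative-cong {F} {F′} {x} {c} F≗F′ D s with D s
... | r , eq = r , trans (sym (F≗F′ (x +ᶻ s))) (trans eq (cong (λ v → v +ᶻ s *ᶻ c +ᶻ s *ᶻ s *ᶻ r) (F≗F′ x)))

hasDerivative-const : ∀ c x → HasDerivative (λ _ → c) x 0ℤ
hasDerivative-const c x s = 0ℤ , solve (c ∷ s ∷ [])

hasDerivative-id : ∀ x → HasDerivative (λ t → t) x 1ℤ
hasDerivative-id x s = 0ℤ , solve (x ∷ s ∷ [])

hasDerivative-diff : ∀ {F G x c d} → HasDerivative F x c → HasDerivative G x d →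
  HasDerivative (λ t → F t - G t) x (c - d)
hasDerivative-diff {F} {G} {x} {c} {d} D E s with D s | E s
... | r , eq | q , eq′ = r - q , trans (cong₂ _-_ eq eq′) (shuffle (F x) (G x))
  where
  shuffle : ∀ u v → (u +ᶻ s *ᶻ c +ᶻ s *ᶻ s *ᶻ r) - (v +ᶻ s *ᶻ d +ᶻ s *ᶻ s *ᶻ q)
                  ≡ (u - v) +ᶻ s *ᶻ (c - d) +ᶻ s *ᶻ s *ᶻ (r - q)
  shuffle u v = solve (s ∷ c ∷ d ∷ r ∷ q ∷ u ∷ v ∷ [])

hasDerivative-* : ∀ {F G x c d} → HasDerivative F x c → HasDerivative G x d →
  HasDerivative (λ t → F t *ᶻ G t) x (c *ᶻ G x +ᶻ F x *ᶻ d)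
hasDerivative-* {F} {G} {x} {c} {d} D E s with D s | E s
... | r , eq | q , eq′ = _ , trans (cong₂ _*ᶻ_ eq eq′) (shuffle (F x) (G x))
  where
  shuffle : ∀ u v → (u +ᶻ s *ᶻ c +ᶻ s *ᶻ s *ᶻ r) *ᶻ (v +ᶻ s *ᶻ d +ᶻ s *ᶻ s *ᶻ q)
                  ≡ u *ᶻ v +ᶻ s *ᶻ (c *ᶻ v +ᶻ u *ᶻ d)
                    +ᶻ s *ᶻ s *ᶻ (u *ᶻ q +ᶻ c *ᶻ d +ᶻ s *ᶻ (c *ᶻ q +ᶻ r *ᶻ d) +ᶻ r *ᶻ v +ᶻ s *ᶻ s *ᶻ (r *ᶻ q))
  shuffle u v = solve (s ∷ c ∷ d ∷ r ∷ q ∷ u ∷ v ∷ [])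

hasDerivative-∘ : ∀ {F G x c d} → HasDerivative G (F x) d → HasDerivative F x c →
  HasDerivative (λ t → G (F t)) x (d *ᶻ c)
hasDerivative-∘ {F} {G} {x} {c} {d} E D s with D s
... | r , eq with E (s *ᶻ c +ᶻ s *ᶻ s *ᶻ r)
... | q , eq′ = _ , trans (cong G (trans eq (ℤₚ.+-assoc (F x) _ _))) (trans eq′ (shuffle (G (F x))))
  where
  shuffle : ∀ u → u +ᶻ (s *ᶻ c +ᶻ s *ᶻ s *ᶻ r) *ᶻ d
                    +ᶻ (s *ᶻ c +ᶻ s *ᶻ s *ᶻ r) *ᶻ (s *ᶻ c +ᶻ s *ᶻ s *ᶻ r) *ᶻ q
                ≡ u +ᶻ s *ᶻ (d *ᶻ c) +ᶻ s *ᶻ s *ᶻ (r *ᶻ d +ᶻ (c +ᶻ s *ᶻ r) *ᶻ (c +ᶻ s *ᶻ r) *ᶻ q)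
  shuffle u = solve (s ∷ c ∷ d ∷ r ∷ q ∷ u ∷ [])

-- Iterates, their derivatives and the quotient by g(x) - x

orbit : ℤ[X] → ℕ → ℤ → ℤ
orbit f zero    x = x
orbit f (suc j) x = eval f (orbit f j x)

eval-iterate : ∀ f j x → eval (iterate f j) x ≡ orbit f j x
eval-iterate f zero    x = eval-X x
eval-iterate f (suc j) x = trans (eval-compose f (iterate f j) x) (cong (eval f) (eval-iterate f j x))

orbit-+ : ∀ f m l x → orbit f (m + l) x ≡ orbit f m (orbit f l x)
orbit-+ f zero    l x = refl
orbit-+ f (suc m) l x = cong (eval f) (orbit-+ f m l x)

orbit-comm : ∀ f m l x → orbit f m (orbit f l x) ≡ orbit f l (orbit f m x)
orbit-comm f m l x = trans (sym (orbit-+ f m l x))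
  (trans (cong (λ j → orbit f j x) (ℕₚ.+-comm m l)) (orbit-+ f l m x))

orbit-iterate : ∀ f k j x → orbit (iterate f k) j x ≡ orbit f (j * k) x
orbit-iterate f k zero    x = refl
orbit-iterate f k (suc j) x = trans (eval-iterate f k _)
  (trans (cong (orbit f k) (orbit-iterate f k j x)) (sym (orbit-+ f k (j * k) x)))

orbit′ : ℤ[X] → ℕ → ℤ → ℤ
orbit′ f j x = eval (derivative (iterate f j)) x

hasDerivative-orbit : ∀ f j x → HasDerivative (orbit f j) x (orbit′ f j x)
hasDerivative-orbit f j x s with hasDerivative-eval (iterate f j) x s
... | r , eq = r , trans (sym (eval-iterate f j (x +ᶻ s)))
  (trans eq (cong (λ v → v +ᶻ s *ᶻ orbit′ f j x +ᶻ s *ᶻ s *ᶻ r) (eval-iterate f j x)))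

-- The chain rule, read off from uniqueness of derivatives: the iterate and the composite need only
-- agree as functions, not as coefficient lists.
orbit′-+ : ∀ f m l x → orbit′ f (m + l) x ≡ orbit′ f m (orbit f l x) *ᶻ orbit′ f l x
orbit′-+ f m l x = hasDerivative-unique (orbit-+ f m l)
  (hasDerivative-orbit f (m + l) x)
  (hasDerivative-∘ {orbit f l} {orbit f m} (hasDerivative-orbit f m _) (hasDerivative-orbit f l x))

orbit′-suc : ∀ f l x → orbit′ f (suc l) x ≡ eval (derivative f) (orbit f l x) *ᶻ orbit′ f l x
orbit′-suc f l x = hasDerivative-unique {orbit f (suc l)} (λ _ → refl) (hasDerivative-orbit f (suc l) x)
  (hasDerivative-∘ {orbit f l} {eval f} (hasDerivative-eval f _) (hasDerivative-orbit f l x))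

-- For `j = d` this is the polynomial Q. The recursion comes from `g^(j+1)(x) - x = (g(g^j(x)) -
-- g(x)) + (g(x) - x)`, whose first bracket is a multiple of `g^j(x) - x`.
orbit-quotient : ℤ[X] → ℕ → ℤ[X]
orbit-quotient g zero    = []
orbit-quotient g (suc j) = (diffQuot g (iterate g j) X ⊛ orbit-quotient g j) ⊕ (1ℤ ∷ [])

orbit-quotient-* : ∀ g j x → orbit g j x - x ≡ eval (orbit-quotient g j) x *ᶻ (eval g x - x)
orbit-quotient-* g zero    x = trans (ℤₚ.+-inverseʳ x) (sym (ℤₚ.*-zeroˡ (eval g x - x)))
orbit-quotient-* g (suc j) x = begin
  eval g y - x
    ≡⟨ split (eval g y) (eval g x) ⟩
  (eval g y - eval g x) +ᶻ (eval g x - x)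
    ≡⟨ cong (_+ᶻ (eval g x - x)) (cong₂ (λ u v → eval g u - eval g v) (eval-iterate g j x) (eval-X x)) ⟨
  (eval g (eval (iterate g j) x) - eval g (eval X x)) +ᶻ (eval g x - x)
    ≡⟨ cong (_+ᶻ (eval g x - x)) (eval-diffQuot g (iterate g j) X x) ⟩
  (eval (iterate g j) x - eval X x) *ᶻ e +ᶻ (eval g x - x)
    ≡⟨ cong (λ v → v *ᶻ e +ᶻ (eval g x - x)) (cong₂ _-_ (eval-iterate g j x) (eval-X x)) ⟩
  (y - x) *ᶻ e +ᶻ (eval g x - x)
    ≡⟨ cong (λ v → v *ᶻ e +ᶻ (eval g x - x)) (orbit-quotient-* g j x) ⟩
  q *ᶻ (eval g x - x) *ᶻ e +ᶻ (eval g x - x)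
    ≡⟨ collect q e (eval g x - x) ⟩
  (e *ᶻ q +ᶻ 1ℤ) *ᶻ (eval g x - x)
    ≡⟨ cong (_*ᶻ (eval g x - x)) (trans (eval-⊕ (E ⊛ orbit-quotient g j) (1ℤ ∷ []) x)
         (cong₂ _+ᶻ_ (eval-⊛ E (orbit-quotient g j) x) (eval-const 1ℤ x))) ⟨
  eval (orbit-quotient g (suc j)) x *ᶻ (eval g x - x) ∎
  where
  open ≡-Reasoning
  y = orbit g j x
  E = diffQuot g (iterate g j) X
  e = eval E x
  q = eval (orbit-quotient g j) x
  split : ∀ u v → u - x ≡ (u - v) +ᶻ (v - x)
  split u v = solve (x ∷ u ∷ v ∷ [])
  collect : ∀ q e s → q *ᶻ s *ᶻ e +ᶻ s ≡ (e *ᶻ q +ᶻ 1ℤ) *ᶻ s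
  collect q e s = solve (q ∷ e ∷ s ∷ [])

-- Divisibility by powers of a prime

∣-sym : ∀ {k} x y → k ∣ x - y → k ∣ y - x
∣-sym {k} x y d = subst (k ∣_) (flip x y) (∣m⇒∣-m d)
  where
  flip : ∀ x y → - (x - y) ≡ y - x
  flip x y = solve (x ∷ y ∷ [])

∣-chain : ∀ {k} x y z → k ∣ x - y → k ∣ y - z → k ∣ x - z
∣-chain {k} x y z d e = subst (k ∣_) (glue x y z) (∣m∣n⇒∣m+n d e)
  where
  glue : ∀ x y z → (x - y) +ᶻ (y - z) ≡ x - z
  glue x y z = solve (x ∷ y ∷ z ∷ [])

∣-diff : ∀ {k} x y → k ∣ x - y → k ∣ y → k ∣ x
∣-diff {k} x y d e = subst (k ∣_) (cancel x y) (∣m∣n⇒∣m+n d e)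
  where
  cancel : ∀ x y → (x - y) +ᶻ y ≡ x
  cancel x y = solve (x ∷ y ∷ [])

eval-mod : ∀ {k} f x y → k ∣ x - y → k ∣ eval f x - eval f y
eval-mod f x y d = ∣-trans d (x-y∣P[x]-P[y] f x y)

orbit-mod : ∀ {k} f j x y → k ∣ x - y → k ∣ orbit f j x - orbit f j y
orbit-mod f zero    x y d = d
orbit-mod f (suc j) x y d = eval-mod f _ _ (orbit-mod f j x y d)

module PrimePowers (p : ℕ) (p-prime : Prime p) where

  instance
    p≢0 : ℕ.NonZero p
    p≢0 = prime⇒nonZero p-prime

  P : ℕ → ℤ
  P m = + (p ^ m)

  P≢0 : ∀ m → ℤ.NonZero (P m)
  P≢0 m = ℕₚ.m^n≢0 p m

  P1≡p : P 1 ≡ + p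
  P1≡p = cong +_ (ℕₚ.^-identityʳ p)

  P-+ : ∀ m n → P (m + n) ≡ P m *ᶻ P n
  P-+ m n = trans (cong +_ (ℕₚ.^-distribˡ-+-* p m n)) (ℤₚ.pos-* (p ^ m) (p ^ n))

  P0∣ : ∀ x → P 0 ∣ x
  P0∣ x = divides x (sym (ℤₚ.*-identityʳ x))

  P-mono : ∀ {m n} → m ≤ n → P m ∣ P n
  P-mono {m} {n} m≤n = subst (λ k → P m ∣ P k) (ℕₚ.m+[n∸m]≡n m≤n)
    (subst (P m ∣_) (sym (P-+ m (n ∸ m))) (∣m⇒∣m*n (P (n ∸ m)) ∣-refl))

  P-weaken : ∀ m n {x} → m ≤ n → P n ∣ x → P m ∣ x
  P-weaken _ _ m≤n d = ∣-trans (P-mono m≤n) d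

  P-∣-* : ∀ m n {x y} → P m ∣ x → P n ∣ y → P (m + n) ∣ x *ᶻ y
  P-∣-* m n (divides q refl) (divides r refl) =
    divides (q *ᶻ r) (trans (shuffle (P m) (P n)) (cong (q *ᶻ r *ᶻ_) (sym (P-+ m n))))
    where
    shuffle : ∀ a b → q *ᶻ a *ᶻ (r *ᶻ b) ≡ q *ᶻ r *ᶻ (a *ᶻ b)
    shuffle a b = solve (q ∷ r ∷ a ∷ b ∷ [])

  euclid : ∀ x y → P 1 ∣ x *ᶻ y → P 1 ∣ x ⊎ P 1 ∣ y
  euclid x y d = ⊎-map up up (euclidsLemma ℤ.∣ x ∣ ℤ.∣ y ∣ p-prime
    (subst (p ℕ∣.∣_) (ℤₚ.abs-* x y) (∣⇒∣ᵤ (subst (_∣ x *ᶻ y) P1≡p d))))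
    where
    up : ∀ {z} → p ℕ∣.∣ ℤ.∣ z ∣ → P 1 ∣ z
    up {z} e = subst (_∣ z) (sym P1≡p) (∣ᵤ⇒∣ e)

  unit-* : ∀ {x y} → ¬ P 1 ∣ x → ¬ P 1 ∣ y → ¬ P 1 ∣ x *ᶻ y
  unit-* {x} {y} ux uy d = [ ux , uy ]′ (euclid x y d)

  unit-mod : ∀ x y → P 1 ∣ x - y → ¬ P 1 ∣ y → ¬ P 1 ∣ x
  unit-mod x y d uy e = uy (∣-diff y x (∣-sym x y d) e)

  -- Euclid's lemma moves one factor p into `x`; cancelling it leaves the same problem for `m - 1`.
  cancel-unit : ∀ m u x → ¬ P 1 ∣ u → P m ∣ u *ᶻ x → P m ∣ x
  cancel-unit zero    u x _  _ = P0∣ x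
  cancel-unit (suc m) u x ¬u d with euclid u x (P-weaken 1 (suc m) (s≤s z≤n) d)
  ... | inj₁ p∣u = contradiction p∣u ¬u
  ... | inj₂ (divides q refl) = subst (P (suc m) ∣_) (ℤₚ.*-comm (P 1) q)
    (P-∣-* 1 m ∣-refl (cancel-unit m u q ¬u
      (*-cancelˡ-∣ (P 1) {{P≢0 1}} (subst₂ _∣_ (P-+ 1 m) (shuffle (P 1)) d))))
    where
    shuffle : ∀ a → u *ᶻ (q *ᶻ a) ≡ a *ᶻ (u *ᶻ q)
    shuffle a = solve (u ∷ q ∷ a ∷ [])

  -- Here `s` is `p^n` times a unit mod p. For `c ≤ n` the truncated exponent is 0 and nothing is
  -- claimed.
  cancel-exact : ∀ n c s x → P n ∣ s → ¬ P (suc n) ∣ s → P c ∣ s *ᶻ x → P (c ∸ n) ∣ x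
  cancel-exact n c _ x (divides u refl) ¬s d with ℕₚ.≤-total n c
  ... | inj₂ c≤n = subst (λ k → P k ∣ x) (sym (ℕₚ.m≤n⇒m∸n≡0 c≤n)) (P0∣ x)
  ... | inj₁ n≤c = cancel-unit (c ∸ n) u x (λ e → ¬s (P-∣-* 1 n e ∣-refl))
    (*-cancelˡ-∣ (P n) {{P≢0 n}} (subst₂ _∣_ (trans (cong P (sym (ℕₚ.m+[n∸m]≡n n≤c))) (P-+ n (c ∸ n))) (shuffle (P n)) d))
    where
    shuffle : ∀ a → u *ᶻ a *ᶻ x ≡ a *ᶻ (u *ᶻ x)
    shuffle a = solve (u ∷ x ∷ a ∷ [])

  -- Newton interpolation: each node gains a factor pⁿ for the remainder,
  -- since differences of nodes are exactly divisible by pⁿ.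
  interpolation : ∀ {n} m {c} F v (z : ℕ → ℤ) t → c ≤ m * n →
    (∀ {i} → i < m → P n ∣ t - z i) →
    (∀ {i j} → i < j → j < m → ¬ P (suc n) ∣ z j - z i) →
    (∀ {i} → i < m → P c ∣ eval F (z i) - v) →
    P c ∣ eval F t - v × P c ∣ P n *ᶻ eval (derivative F) t
  interpolation zero    F v z t z≤n _ _ _ = P0∣ _ , P0∣ _
  interpolation {n} (suc m) {c} F v z t c≤ near distinct vanish = F∣ , F′∣
    where
    z₀ = z 0
    F₁ = diffQuot F X (z₀ ∷ [])

    F-F₁ : ∀ x → eval F x - eval F z₀ ≡ (x - z₀) *ᶻ eval F₁ x
    F-F₁ x = subst₂ (λ a b → eval F a - eval F b ≡ (a - b) *ᶻ eval F₁ x)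
      (eval-X x) (eval-const z₀ x) (eval-diffQuot F X (z₀ ∷ []) x)

    -- `F` takes nearly the same value at `z₀` and at each later node, and the nodes differ by
    -- exactly `p^n`, so dividing by the difference costs exactly n powers of p. The induction
    -- continues with `F₁`, target value 0 and one node fewer.
    F₁-vanish : ∀ {i} → i < m → P (c ∸ n) ∣ eval F₁ (z (suc i)) - 0ℤ
    F₁-vanish {i} i<m = subst (P (c ∸ n) ∣_) (sym (ℤₚ.+-identityʳ _))
      (cancel-exact n c (zᵢ - z₀) (eval F₁ zᵢ)
        (∣-chain zᵢ t z₀ (∣-sym t zᵢ (near (s≤s i<m))) (near (s≤s z≤n)))
        (distinct (s≤s z≤n) (s≤s i<m))
        (subst (P c ∣_) (F-F₁ zᵢ)
          (∣-chain (eval F zᵢ) v (eval F z₀) (vanish (s≤s i<m)) (∣-sym (eval F z₀) v (vanish (s≤s z≤n))))))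
      where zᵢ = z (suc i)

    IH = interpolation m F₁ 0ℤ (λ i → z (suc i)) t (ℕₚ.m≤n+o⇒m∸n≤o c n c≤)
      (λ i<m → near (s≤s i<m)) (λ i<j j<m → distinct (s≤s i<j) (s≤s j<m)) F₁-vanish

    c≤n+ : c ≤ n + (c ∸ n)
    c≤n+ = ℕₚ.m≤n+m∸n c n

    F₁∣ : P (c ∸ n) ∣ eval F₁ t
    F₁∣ = subst (P (c ∸ n) ∣_) (ℤₚ.+-identityʳ _) (proj₁ IH)

    F∣ : P c ∣ eval F t - v
    F∣ = ∣-chain (eval F t) (eval F z₀) v
      (subst (P c ∣_) (sym (F-F₁ t)) (P-weaken c (n + (c ∸ n)) c≤n+ (P-∣-* n (c ∸ n) (near (s≤s z≤n)) F₁∣)))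
      (vanish (s≤s z≤n))

    F′≡ : eval (derivative F) t ≡ eval F₁ t +ᶻ (t - z₀) *ᶻ eval (derivative F₁) t
    F′≡ = trans (sym (ℤₚ.+-identityʳ _)) (trans
      (hasDerivative-unique F-F₁
        (hasDerivative-diff {eval F} {λ _ → eval F z₀} (hasDerivative-eval F t) (hasDerivative-const (eval F z₀) t))
        (hasDerivative-* {λ x → x - z₀} {eval F₁} {t} {1ℤ}
          (hasDerivative-diff {λ x → x} {λ _ → z₀} {t} {1ℤ} {0ℤ} (hasDerivative-id t) (hasDerivative-const z₀ t))
          (hasDerivative-eval F₁ t)))
      (cong (_+ᶻ (t - z₀) *ᶻ eval (derivative F₁) t) (ℤₚ.*-identityˡ (eval F₁ t))))

    -- Differentiating may lose the factor `p^n` of one node; the weight `P n` makes up for it in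
    -- both terms of the product rule.
    F′∣ : P c ∣ P n *ᶻ eval (derivative F) t
    F′∣ = subst (P c ∣_)
      (trans (shuffle (P n) (eval F₁ t) (eval (derivative F₁) t) (t - z₀)) (cong (P n *ᶻ_) (sym F′≡)))
      (∣m∣n⇒∣m+n (P-weaken c (n + (c ∸ n)) c≤n+ (P-∣-* n (c ∸ n) ∣-refl F₁∣))
                 (P-weaken c (n + (c ∸ n)) c≤n+ (P-∣-* n (c ∸ n) (near (s≤s z≤n)) (proj₂ IH))))
      where
      shuffle : ∀ a u v s → a *ᶻ u +ᶻ s *ᶻ (a *ᶻ v) ≡ a *ᶻ (u +ᶻ s *ᶻ v)
      shuffle a u v s = solve (a ∷ u ∷ v ∷ s ∷ [])

  -- Local analysis at one point of the lift

  module NearPoint {n d : ℕ} (1≤n : 1 ≤ n) (1<d : 1 < d) (g : ℤ[X]) (w : ℤ)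
    (near : ∀ j → P n ∣ orbit g j w - w)
    (distinct : ∀ {i j} → i < j → j < d → ¬ P (suc n) ∣ orbit g j w - orbit g i w)
    (g′≢0 : ¬ P 1 ∣ eval (derivative g) w)
    (g′≢1 : ¬ P 1 ∣ eval (derivative g) w - 1ℤ) where

    Q : ℤ → ℤ
    Q = eval (orbit-quotient g d)

    Q′ : ℤ → ℤ
    Q′ = eval (derivative (orbit-quotient g d))

    -- Since h and g commute, `h(g(x)) - g(x)` equals both `Q(g(x)) (g(g(x)) - g(x))` and
    -- `g(h(x)) - g(x)`. Expanding g at `x` with increments `s` and `δ = Q(x) s` and cancelling `s`
    -- makes `Q(g(x)) - Q(x)`, up to the unit `c₀ + s r`, a multiple of `Q(x) s`.
    Q-step : ∀ c x → P n ∣ eval g x - x → ¬ P (suc n) ∣ eval g x - x →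
      ¬ P 1 ∣ eval (derivative g) x → P c ∣ P n *ᶻ Q x → P c ∣ Q (eval g x) - Q x
    Q-step c x n∣s ¬s ug c∣ with hasDerivative-eval g x (eval g x - x) | hasDerivative-eval g x (orbit g d x - x)
    ... | r , eq | q , eq′ = cancel-unit c (c₀ +ᶻ s *ᶻ r) (Q (eval g x) - Q x)
        (unit-mod (c₀ +ᶻ s *ᶻ r) c₀ (subst (P 1 ∣_) (sym (drop c₀ (s *ᶻ r))) (∣m⇒∣m*n r (P-weaken 1 n 1≤n n∣s))) ug)
        (subst (P c ∣_) (sym difference) (∣m⇒∣m*n (Q x *ᶻ q - r)
          (∣-trans c∣ (subst (P n *ᶻ Q x ∣_) (ℤₚ.*-comm s (Q x)) (*-monoˡ-∣ (Q x) n∣s)))))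
      where
      open ≡-Reasoning
      s = eval g x - x
      c₀ = eval (derivative g) x
      δ = orbit g d x - x

      instance
        -- Exact divisibility by `p^n` rules out `s = 0`, so `s` may be cancelled from `both`.
        s≢0 : ℤ.NonZero s
        s≢0 = ℤ.≢-nonZero (λ s≡0 → ¬s (subst (P (suc n) ∣_) (sym s≡0) (divides 0ℤ refl)))

      drop : ∀ a b → a +ᶻ b - a ≡ b
      drop a b = solve (a ∷ b ∷ [])

      restore : ∀ a b → a +ᶻ (b - a) ≡ b
      restore a b = solve (a ∷ b ∷ [])

      taylor : ∀ y (e : ℤ) → eval g (x +ᶻ (y - x)) ≡ eval g x +ᶻ (y - x) *ᶻ c₀ +ᶻ (y - x) *ᶻ (y - x) *ᶻ e →
               eval g y - eval g x ≡ (y - x) *ᶻ (c₀ +ᶻ (y - x) *ᶻ e)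
      taylor y e E = trans (cong (_- eval g x) (trans (cong (eval g) (sym (restore x y))) E))
                           (collect (eval g x) (y - x) c₀)
        where
        collect : ∀ u h c₀ → u +ᶻ h *ᶻ c₀ +ᶻ h *ᶻ h *ᶻ e - u ≡ h *ᶻ (c₀ +ᶻ h *ᶻ e)
        collect u h c₀ = solve (u ∷ h ∷ c₀ ∷ e ∷ [])

      both : s *ᶻ (Q (eval g x) *ᶻ (c₀ +ᶻ s *ᶻ r)) ≡ s *ᶻ (Q x *ᶻ (c₀ +ᶻ Q x *ᶻ s *ᶻ q))
      both = begin
        s *ᶻ (Q (eval g x) *ᶻ (c₀ +ᶻ s *ᶻ r))
          ≡⟨ swap s (Q (eval g x)) (c₀ +ᶻ s *ᶻ r) ⟩
        Q (eval g x) *ᶻ (s *ᶻ (c₀ +ᶻ s *ᶻ r))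
          ≡⟨ cong (Q (eval g x) *ᶻ_) (taylor (eval g x) r eq) ⟨
        Q (eval g x) *ᶻ (eval g (eval g x) - eval g x)
          ≡⟨ orbit-quotient-* g d (eval g x) ⟨
        orbit g d (eval g x) - eval g x
          ≡⟨ cong (_- eval g x) (orbit-comm g d 1 x) ⟩
        eval g (orbit g d x) - eval g x
          ≡⟨ taylor (orbit g d x) q eq′ ⟩
        δ *ᶻ (c₀ +ᶻ δ *ᶻ q)
          ≡⟨ cong (λ v → v *ᶻ (c₀ +ᶻ v *ᶻ q)) (orbit-quotient-* g d x) ⟩
        Q x *ᶻ s *ᶻ (c₀ +ᶻ Q x *ᶻ s *ᶻ q)
          ≡⟨ swap′ s (Q x) (c₀ +ᶻ Q x *ᶻ s *ᶻ q) ⟩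
        s *ᶻ (Q x *ᶻ (c₀ +ᶻ Q x *ᶻ s *ᶻ q)) ∎
        where
        swap : ∀ s a b → s *ᶻ (a *ᶻ b) ≡ a *ᶻ (s *ᶻ b)
        swap s a b = solve (s ∷ a ∷ b ∷ [])
        swap′ : ∀ s a b → a *ᶻ s *ᶻ b ≡ s *ᶻ (a *ᶻ b)
        swap′ s a b = solve (s ∷ a ∷ b ∷ [])

      difference : (c₀ +ᶻ s *ᶻ r) *ᶻ (Q (eval g x) - Q x) ≡ Q x *ᶻ s *ᶻ (Q x *ᶻ q - r)
      difference = begin
        (c₀ +ᶻ s *ᶻ r) *ᶻ (Q (eval g x) - Q x)
          ≡⟨ expand c₀ s (Q (eval g x)) (Q x) ⟩
        Q (eval g x) *ᶻ (c₀ +ᶻ s *ᶻ r) - Q x *ᶻ (c₀ +ᶻ s *ᶻ r)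
          ≡⟨ cong (_- Q x *ᶻ (c₀ +ᶻ s *ᶻ r)) (ℤₚ.*-cancelˡ-≡ s _ _ both) ⟩
        Q x *ᶻ (c₀ +ᶻ Q x *ᶻ s *ᶻ q) - Q x *ᶻ (c₀ +ᶻ s *ᶻ r)
          ≡⟨ collect c₀ s (Q x) ⟩
        Q x *ᶻ s *ᶻ (Q x *ᶻ q - r) ∎
        where
        expand : ∀ c₀ s a b → (c₀ +ᶻ s *ᶻ r) *ᶻ (a - b) ≡ a *ᶻ (c₀ +ᶻ s *ᶻ r) - b *ᶻ (c₀ +ᶻ s *ᶻ r)
        expand c₀ s a b = solve (c₀ ∷ s ∷ r ∷ a ∷ b ∷ [])
        collect : ∀ c₀ s b → b *ᶻ (c₀ +ᶻ b *ᶻ s *ᶻ q) - b *ᶻ (c₀ +ᶻ s *ᶻ r) ≡ b *ᶻ s *ᶻ (b *ᶻ q - r)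
        collect c₀ s b = solve (c₀ ∷ s ∷ r ∷ q ∷ b ∷ [])

    -- Telescoping `Q-step`. The congruence already obtained at step `j` also transports the
    -- hypothesis on `P n *ᶻ Q w` to the current point, where the next step needs it.
    Q-orbit : ∀ c j → j < d → P c ∣ P n *ᶻ Q w → P c ∣ Q (orbit g j w) - Q w
    Q-orbit c zero  _   c∣ = subst (P c ∣_) (sym (ℤₚ.+-inverseʳ (Q w))) (divides 0ℤ refl)
    Q-orbit c (suc j) j<d c∣ = ∣-chain (Q (eval g z)) (Q z) (Q w)
      (Q-step c z
        (∣-chain (eval g z) w z (near (suc j)) (∣-sym z w (near j)))
        (distinct ℕₚ.≤-refl j<d)
        (unit-mod (eval (derivative g) z) (eval (derivative g) w)
          (P-weaken 1 n 1≤n (eval-mod (derivative g) z w (near j))) g′≢0)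
        (∣-diff (P n *ᶻ Q z) (P n *ᶻ Q w)
          (subst (P c ∣_) (dist (P n) (Q z) (Q w)) (∣n⇒∣m*n (P n) IH)) c∣))
      IH
      where
      z = orbit g j w
      IH = Q-orbit c j (ℕₚ.<-trans (ℕₚ.n<1+n j) j<d) c∣
      dist : ∀ a u v → a *ᶻ (u - v) ≡ a *ᶻ u - a *ᶻ v
      dist a u v = solve (a ∷ u ∷ v ∷ [])

    -- Interpolation of Q by the constant `Q w` at the nodes `w, g(w), ..., g^(d-1)(w)`; the d nodes
    -- account for the bound `d * n`.
    Q-nearby : ∀ c t → c ≤ d * n → P n ∣ t - w → P c ∣ P n *ᶻ Q w →
      P c ∣ Q t - Q w × P c ∣ P n *ᶻ Q′ t
    Q-nearby c t c≤ t≡w c∣ = interpolation d (orbit-quotient g d) (Q w) (λ j → orbit g j w) t c≤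
      (λ {i} _ → ∣-chain t w (orbit g i w) t≡w (∣-sym (orbit g i w) w (near i)))
      distinct (λ i<d → Q-orbit c _ i<d c∣)

    Q-nearby-∣ : ∀ m t → m ≤ d * n → P n ∣ t - w → P m ∣ Q w → P m ∣ Q t
    Q-nearby-∣ m t m≤ t≡w m∣ = ∣-diff (Q t) (Q w) (proj₁ (Q-nearby m t m≤ t≡w (∣n⇒∣m*n (P n) m∣))) m∣

    s : ℤ
    s = eval g w - w

    n∣s : P n ∣ s
    n∣s = near 1

    ¬s : ¬ P (suc n) ∣ s
    ¬s = distinct ℕₚ.≤-refl 1<d

    Q⇒return : ∀ m → P m ∣ Q w → P (n + m) ∣ orbit g d w - w
    Q⇒return m m∣ = subst (P (n + m) ∣_)
      (trans (ℤₚ.*-comm s (Q w)) (sym (orbit-quotient-* g d w))) (P-∣-* n m n∣s m∣)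

    return⇒Q : ∀ m → P (n + m) ∣ orbit g d w - w → P m ∣ Q w
    return⇒Q m d∣ = subst (λ k → P k ∣ Q w) (ℕₚ.m+n∸m≡n n m)
      (cancel-exact n (n + m) s (Q w) n∣s ¬s
        (subst (P (n + m) ∣_) (trans (orbit-quotient-* g d w) (ℤₚ.*-comm (Q w) s)) d∣))

    module _ {h′ : ℤ} (h-deriv : HasDerivative (orbit g d) w h′) where

      h′-1≡ : h′ - 1ℤ ≡ Q′ w *ᶻ s +ᶻ Q w *ᶻ (eval (derivative g) w - 1ℤ)
      h′-1≡ = hasDerivative-unique (orbit-quotient-* g d)
        (hasDerivative-diff {orbit g d} {λ x → x} h-deriv (hasDerivative-id w))
        (hasDerivative-* {Q} {λ x → eval g x - x} (hasDerivative-eval (orbit-quotient g d) w)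
          (hasDerivative-diff {eval g} {λ x → x} (hasDerivative-eval g w) (hasDerivative-id w)))

      -- As `n ≥ 1`, divisibility of `Q w` by `p^m` already makes `P n *ᶻ Q w` divisible by
      -- `p^(m+1)`. This extra power of p is what lets the induction in `h′⇒Q` advance.
      Q′s∣ : ∀ m → suc m ≤ d * n → P m ∣ Q w → P (suc m) ∣ Q′ w *ᶻ s
      Q′s∣ m m< m∣ = subst (P (suc m) ∣_) (ℤₚ.*-comm s (Q′ w))
        (∣-trans (proj₂ (Q-nearby (suc m) w m< (subst (P n ∣_) (sym (ℤₚ.+-inverseʳ w)) (divides 0ℤ refl))
                   (P-weaken (suc m) (n + m) (ℕₚ.+-monoˡ-≤ m 1≤n) (P-∣-* n m ∣-refl m∣))))
          (*-monoˡ-∣ (Q′ w) n∣s))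

      Q⇒h′ : ∀ m → m ≤ d * n → P m ∣ Q w → P m ∣ h′ - 1ℤ
      Q⇒h′ zero    _  _  = P0∣ _
      Q⇒h′ (suc m) m< m∣ = subst (P (suc m) ∣_) (sym h′-1≡)
        (∣m∣n⇒∣m+n (Q′s∣ m m< (P-weaken m (suc m) (ℕₚ.n≤1+n m) m∣)) (∣m⇒∣m*n _ m∣))

      -- By induction `p^m` divides `Q w`, so the term `Q′ w *ᶻ s` vanishes mod `p^(m+1)`; the
      -- remaining term is `Q w` times the unit `g′(w) - 1`.
      h′⇒Q : ∀ m → m ≤ d * n → P m ∣ h′ - 1ℤ → P m ∣ Q w
      h′⇒Q zero    _  _  = P0∣ _
      h′⇒Q (suc m) m< m∣ = cancel-unit (suc m) (eval (derivative g) w - 1ℤ) (Q w) g′≢1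
        (subst (P (suc m) ∣_) (ℤₚ.*-comm (Q w) _)
          (∣m+n∣m⇒∣n (subst (P (suc m) ∣_) h′-1≡ m∣)
            (Q′s∣ m m< (h′⇒Q m (ℕₚ.<⇒≤ m<) (P-weaken m (suc m) (ℕₚ.n≤1+n m) m∣)))))

-- Valuations

greatest≤-holds : ∀ {R : ℕ → Set} (R? : Decidable R) b → R 0 → R (greatest≤ R? b)
greatest≤-holds R? zero    r₀ = r₀
greatest≤-holds R? (suc b) r₀ with R? (suc b)
... | yes r = r
... | no  _ = greatest≤-holds R? b r₀

greatest≤-maximal : ∀ {R : ℕ → Set} (R? : Decidable R) b {e} → e ≤ b → R e → e ≤ greatest≤ R? b
greatest≤-maximal R? zero    e≤b r = e≤b
greatest≤-maximal R? (suc b) e≤b r with R? (suc b)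
... | yes _ = e≤b
... | no ¬r = greatest≤-maximal R? b
  (ℕₚ.≤-pred (ℕₚ.≤∧≢⇒< e≤b (λ { refl → ¬r r }))) r

module Valuation (p : ℕ) (p-prime : Prime p) where
  open PrimePowers p p-prime

  1<p : 1 < p
  1<p = ℕ.nonTrivial⇒n>1 p {{prime⇒nonTrivial p-prime}}

  n<p^n : ∀ n → n < p ^ n
  n<p^n zero    = s≤s z≤n
  n<p^n (suc n) = ℕₚ.≤-<-trans (n<p^n n) (ℕₚ.^-monoʳ-< p 1<p (ℕₚ.n<1+n n))

  P∣⇒≤ : ∀ e {z} → z ≢ 0ℤ → P e ∣ z → e ≤ ℤ.∣ z ∣
  P∣⇒≤ e {z} z≢0 d = ℕₚ.<⇒≤ (ℕₚ.<-≤-trans (n<p^n e) (ℕ∣.∣⇒≤ {{ℤ.≢-nonZero z≢0}} (∣⇒∣ᵤ d)))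

  ord-sound : ∀ z {e} → ord p z ≡ [ e ] → P e ∣ z × ¬ P (suc e) ∣ z
  ord-sound z eq with z ℤ.≟ 0ℤ
  ord-sound z refl | no z≢0 =
    greatest≤-holds (λ e → P e ∣? z) ℤ.∣ z ∣ (P0∣ z) ,
    λ d → ℕₚ.<⇒≱ (ℕₚ.n<1+n _) (greatest≤-maximal (λ e → P e ∣? z) ℤ.∣ z ∣ (P∣⇒≤ _ z≢0 d) d)

  ord-complete : ∀ z {e} → P e ∣ z → ¬ P (suc e) ∣ z → ord p z ≡ [ e ]
  ord-complete z {e} d ¬d with z ℤ.≟ 0ℤ
  ... | yes refl = contradiction (divides 0ℤ refl) ¬d
  ... | no z≢0 = cong [_] (ℕₚ.≤-antisym
    (ℕₚ.≮⇒≥ (λ e<g → ¬d (P-weaken (suc e) _ e<g (greatest≤-holds (λ e → P e ∣? z) ℤ.∣ z ∣ (P0∣ z)))))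
    (greatest≤-maximal (λ e → P e ∣? z) ℤ.∣ z ∣ (P∣⇒≤ e z≢0 d) d))

  ≤ord⇒∣ : ∀ m z → [ m ] ≤⁺ ord p z → P m ∣ z
  ≤ord⇒∣ m z m≤ with z ℤ.≟ 0ℤ
  ≤ord⇒∣ m z m≤        | yes refl = divides 0ℤ refl
  ≤ord⇒∣ m z ≤⁺.[ m≤ ] | no _     = P-weaken m _ m≤ (greatest≤-holds (λ e → P e ∣? z) ℤ.∣ z ∣ (P0∣ z))

  -- If the valuation e is below `n`, then `e + 1 ≤ n`, so the congruence preserves both
  -- divisibility by `p^e` and non-divisibility by `p^(e+1)`.
  ord-mod : ∀ n z z′ → P n ∣ z′ - z → ord p z <⁺ [ n ] → ord p z′ ≡ ord p z
  ord-mod n z z′ n∣ lt with ord p z in eq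
  ord-mod n z z′ n∣ <⁺.[ e<n ] | [ e ] with ord-sound z eq
  ... | d , ¬d = ord-complete z′
    (∣-diff z′ z (P-weaken e n (ℕₚ.<⇒≤ e<n) n∣) d)
    (λ d′ → ¬d (∣-diff z z′ (∣-sym z′ z (P-weaken (suc e) n e<n n∣)) d′))

  module _ (M : ℕ) .{{_ : ℕ.NonZero (p ^ M)}} {z : ℤ} (M∣z : P M ∣ z) where

    -- The remainder is smaller than `p ^ M` and divisible by it, hence 0. This turns statements
    -- about the quotient `b` into divisibility statements.
    /ℕ-exact : z ≡ z /ℕ (p ^ M) *ᶻ P M
    /ℕ-exact = trans (a≡a%ℕn+[a/ℕn]*n z (p ^ M))
      (trans (cong (λ r → + r +ᶻ z /ℕ (p ^ M) *ᶻ P M) r≡0) (ℤₚ.+-identityˡ _))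
      where
      p^M∣r : p ^ M ℕ∣.∣ z %ℕ (p ^ M)
      p^M∣r = ∣⇒∣ᵤ (∣m+n∣n⇒∣m {m = + (z %ℕ (p ^ M))} (subst (P M ∣_) (a≡a%ℕn+[a/ℕn]*n z (p ^ M)) M∣z)
        (∣n⇒∣m*n (z /ℕ (p ^ M)) ∣-refl))
      r≡0 : z %ℕ (p ^ M) ≡ 0
      r≡0 = trans (sym (m<n⇒m%n≡m (n%ℕd<d z (p ^ M)))) (ℕ∣.n∣m⇒m%n≡0 (z %ℕ (p ^ M)) (p ^ M) p^M∣r)

    ∣⇒p∣quotient : P (suc M) ∣ z → P 1 ∣ z /ℕ (p ^ M)
    ∣⇒p∣quotient d = *-cancelʳ-∣ (P M) {{P≢0 M}} (subst₂ _∣_ (P-+ 1 M) /ℕ-exact d)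

    p∣quotient⇒∣ : P 1 ∣ z /ℕ (p ^ M) → P (suc M) ∣ z
    p∣quotient⇒∣ d = subst₂ _∣_ (sym (P-+ 1 M)) (sym /ℕ-exact) (*-monoˡ-∣ (P M) d)

-- Cycles

[a+b%n]%n≡[a+b]%n : ∀ a b n .{{_ : ℕ.NonZero n}} → (a + b % n) % n ≡ (a + b) % n
[a+b%n]%n≡[a+b]%n a b n = trans (%-distribˡ-+ a (b % n) n)
  (trans (cong (λ r → (a % n + r) % n) (m%n%n≡m%n b n)) (sym (%-distribˡ-+ a b n)))

mod-cong : ∀ a b n .{{_ : ℕ.NonZero n}} → a % n ≡ b % n → a mod n ≡ b mod n
mod-cong a b n eq = fromℕ<-cong _ _ eq (m%n<n a n) (m%n<n b n)

toℕ-mod : ∀ {n} (i : Fin n) .{{_ : ℕ.NonZero n}} → toℕ i mod n ≡ i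
toℕ-mod {n} i = toℕ-injective (trans (toℕ-fromℕ< (m%n<n (toℕ i) n)) (m<n⇒m%n≡m (toℕ<n i)))

module Cycles (p : ℕ) (p-prime : Prime p) (f : ℤ[X]) where
  open PrimePowers p p-prime
  open Valuation p p-prime
  open Dynamics p p-prime f

  x₁-∈ : ∀ {N} (τ : Cycle N) → Cycle.x₁ τ ∈ᶜ τ
  x₁-∈ {N} τ = _ , subst (P N ∣_) (sym (ℤₚ.+-inverseʳ (Cycle.x₁ τ))) (divides 0ℤ refl)

  module AlongCycle {N : ℕ} (τ : Cycle N) where
    open Cycle τ using (points; distinct; step)

    L : ℕ
    L = length τ

    instance
      L≢0 : ℕ.NonZero L
      L≢0 = Cycle.length≢0 τ

    orbit-point : ∀ {w i} → P N ∣ w - points i → ∀ j →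
      P N ∣ orbit f j w - points ((toℕ i + j) mod L)
    orbit-point {w} {i} d zero    = subst (λ k → P N ∣ w - points k)
      (sym (trans (cong (_mod L) (ℕₚ.+-identityʳ (toℕ i))) (toℕ-mod i))) d
    orbit-point {w} {i} d (suc j) = subst (λ k → P N ∣ eval f (orbit f j w) - points k) index
      (∣-chain (eval f (orbit f j w)) (eval f (points k)) (points (suc (toℕ k) mod L))
        (eval-mod f (orbit f j w) (points k) (orbit-point d j)) (step k))
      where
      k = (toℕ i + j) mod L
      index : suc (toℕ k) mod L ≡ (toℕ i + suc j) mod L
      index = mod-cong (suc (toℕ k)) (toℕ i + suc j) L
        (trans (cong (λ a → suc a % L) (toℕ-fromℕ< (m%n<n (toℕ i + j) L)))
          (trans ([a+b%n]%n≡[a+b]%n 1 (toℕ i + j) L) (cong (_% L) (sym (ℕₚ.+-suc (toℕ i) j)))))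

    orbit-∈ : ∀ w j → w ∈ᶜ τ → orbit f j w ∈ᶜ τ
    orbit-∈ w j (i , d) = _ , orbit-point d j

    ∣⇒return : ∀ w {j} → w ∈ᶜ τ → L ℕ∣.∣ j → P N ∣ orbit f j w - w
    ∣⇒return w {j} (i , d) (ℕ∣.divides q refl) = ∣-chain (orbit f j w) (points i) w
      (subst (λ k → P N ∣ orbit f j w - points k)
        (trans (mod-cong (toℕ i + q * L) (toℕ i) L ([m+kn]%n≡m%n (toℕ i) q L)) (toℕ-mod i))
        (orbit-point d j))
      (∣-sym w (points i) d)

    -- By `distinct`, a return forces the index `(i + j) mod L` to be `i` again; the quotient of
    -- `i + j` by `L` is then the witness.
    return⇒∣ : ∀ w {j} → w ∈ᶜ τ → P N ∣ orbit f j w - w → L ℕ∣.∣ j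
    return⇒∣ w {j} (i , d) r = ℕ∣.divides ((toℕ i + j) / L)
      (ℕₚ.+-cancelˡ-≡ (toℕ i) j _ (trans (m≡m%n+[m/n]*n (toℕ i + j) L)
        (cong (ℕ._+ (toℕ i + j) / L * L) same)))
      where
      k = (toℕ i + j) mod L
      same : (toℕ i + j) % L ≡ toℕ i
      same = trans (sym (toℕ-fromℕ< (m%n<n (toℕ i + j) L))) (cong toℕ (distinct k i
        (∣-chain (points k) (orbit f j w) (points i)
          (∣-sym (orbit f j w) (points k) (orbit-point d j))
          (∣-chain (orbit f j w) w (points i) r d))))

    reach : ∀ x y → x ∈ᶜ τ → y ∈ᶜ τ → ∃ λ l → l < L × P N ∣ orbit f l x - y
    reach x y (i , d) (j , e) = l , m%n<n l₀ L , ∣-chain (orbit f l x) (points j) y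
      (subst (λ k → P N ∣ orbit f l x - points k) index (orbit-point d l))
      (∣-sym y (points j) e)
      where
      -- First complete the round to index 0, then take `j` more steps; reducing mod `L` gives
      -- `l < L`.
      l₀ = (L ∸ toℕ i) + toℕ j
      l = l₀ % L
      index : (toℕ i + l) mod L ≡ j
      index = trans (mod-cong (toℕ i + l) (toℕ j) L
        (trans ([a+b%n]%n≡[a+b]%n (toℕ i) l₀ L)
          (trans (cong (_% L) around) ([m+kn]%n≡m%n (toℕ j) 1 L)))) (toℕ-mod j)
        where
        around : toℕ i + l₀ ≡ toℕ j + 1 * L
        around = trans (sym (ℕₚ.+-assoc (toℕ i) (L ∸ toℕ i) (toℕ j)))
          (trans (cong (ℕ._+ toℕ j) (ℕₚ.m+[n∸m]≡n (ℕₚ.<⇒≤ (toℕ<n i))))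
            (trans (ℕₚ.+-comm L (toℕ j)) (cong (λ v → toℕ j + v) (sym (ℕₚ.*-identityˡ L)))))

  lift-∈ : ∀ {N} {τ : Cycle N} {τ′ : Cycle (suc N)} → IsLift τ τ′ → ∀ w → w ∈ᶜ τ′ → w ∈ᶜ τ
  lift-∈ {N} {τ} {τ′} isLift w (i , d) with isLift i
  ... | j , e = j , ∣-chain w (Cycle.points τ′ i) (Cycle.points τ j) (P-weaken N (suc N) (ℕₚ.n≤1+n N) d) e

  descendant-∈ : ∀ {N M} {τ : Cycle N} {ρ : Cycle M} → Descendant τ ρ → ∀ w → w ∈ᶜ ρ → w ∈ᶜ τ
  descendant-∈ self w w∈ = w∈
  descendant-∈ (lift {ρ = ρ} {ρ′} D l) w w∈ = descendant-∈ D w (lift-∈ {τ = ρ} {ρ′} l w w∈)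

  descendant-≤ : ∀ {N M} {τ : Cycle N} {ρ : Cycle M} → Descendant τ ρ → N ≤ M
  descendant-≤ self       = ℕₚ.≤-refl
  descendant-≤ (lift D _) = ℕₚ.m≤n⇒m≤1+n (descendant-≤ D)

-- Partially splitting cycles

module PartialSplitting (p : ℕ) (p-prime : Prime p) (f : ℤ[X]) where
  open PrimePowers p p-prime
  open Valuation p p-prime
  open Dynamics p p-prime f
  open Cycles p p-prime f

  module Base {n : ℕ} (1≤n : 1 ≤ n) (σ : Cycle n) (splits : PartiallySplits σ) where
    module σ = AlongCycle σ

    k : ℕ
    k = length σ

    x₁ : ℤ
    x₁ = Cycle.x₁ σ

    a-unit : ¬ P 1 ∣ a σ
    a-unit d = proj₁ splits (subst₂ _∣_ P1≡p (sym (ℤₚ.+-identityʳ (a σ))) d)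

    a-1-unit : ¬ P 1 ∣ a σ - 1ℤ
    a-1-unit d = proj₂ splits (subst (_∣ a σ - 1ℤ) P1≡p d)

    -- `a σ` is the product of the values of f′ along the cycle. Splitting it at the point congruent
    -- to `w` exhibits `f′(w)`, mod p, as a factor of a unit.
    f′-unit : ∀ w → w ∈ᶜ σ → ¬ P 1 ∣ eval (derivative f) w
    f′-unit w w∈ d with σ.reach x₁ w (x₁-∈ σ) w∈
    ... | l , l<k , e = a-unit (subst (P 1 ∣_) (sym factor)
        (∣n⇒∣m*n (orbit′ f m (orbit f (suc l) x₁)) (∣m⇒∣m*n (orbit′ f l x₁)
          (∣-diff (eval (derivative f) (orbit f l x₁)) (eval (derivative f) w)
            (P-weaken 1 n 1≤n (eval-mod (derivative f) (orbit f l x₁) w e)) d))))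
      where
      m = k ∸ suc l
      factor : a σ ≡ orbit′ f m (orbit f (suc l) x₁) *ᶻ (eval (derivative f) (orbit f l x₁) *ᶻ orbit′ f l x₁)
      factor = trans (cong (λ j → orbit′ f j x₁) (sym (ℕₚ.m∸n+n≡m l<k)))
        (trans (orbit′-+ f m (suc l) x₁)
          (cong (orbit′ f m (orbit f (suc l) x₁) *ᶻ_) (orbit′-suc f l x₁)))

    orbit′-unit : ∀ l w → w ∈ᶜ σ → ¬ P 1 ∣ orbit′ f l w
    -- The derivative of the identity is 1; if p divided it, p would also divide `a σ`.
    orbit′-unit zero    w w∈ d = a-unit (subst (P 1 ∣_)
      (trans (cong (a σ *ᶻ_) orbit′-zero) (ℤₚ.*-identityʳ (a σ))) (∣n⇒∣m*n (a σ) d))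
      where
      orbit′-zero : orbit′ f 0 w ≡ 1ℤ
      orbit′-zero = hasDerivative-unique {orbit f 0} {λ x → x} {w} (λ _ → refl) (hasDerivative-orbit f 0 w) (hasDerivative-id w)
    orbit′-unit (suc l) w w∈ d = unit-* {eval (derivative f) (orbit f l w)} {orbit′ f l w}
      (f′-unit (orbit f l w) (σ.orbit-∈ w l w∈)) (orbit′-unit l w w∈)
      (subst (P 1 ∣_) (orbit′-suc f l w) d)

    -- Both orders of differentiating f^(K+l) at x₁ give the same product, and
    -- the common factor (f^l)′(x₁) is a unit.
    orbit′-constant : ∀ {K} → k ℕ∣.∣ K → ∀ w → w ∈ᶜ σ → P n ∣ orbit′ f K w - orbit′ f K x₁
    orbit′-constant {K} k∣K w w∈ with σ.reach x₁ w (x₁-∈ σ) w∈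
    ... | l , _ , e = ∣-chain (orbit′ f K w) (orbit′ f K y) (orbit′ f K x₁)
      (eval-mod (derivative (iterate f K)) w y (∣-sym y w e))
      (cancel-unit n (orbit′ f l x₁) (orbit′ f K y - orbit′ f K x₁) (orbit′-unit l x₁ (x₁-∈ σ))
        (subst (P n ∣_) (sym difference) (∣n⇒∣m*n (orbit′ f K x₁)
          (eval-mod (derivative (iterate f l)) (orbit f K x₁) x₁ (σ.∣⇒return x₁ (x₁-∈ σ) k∣K)))))
      where
      y = orbit f l x₁
      difference : orbit′ f l x₁ *ᶻ (orbit′ f K y - orbit′ f K x₁)
                 ≡ orbit′ f K x₁ *ᶻ (orbit′ f l (orbit f K x₁) - orbit′ f l x₁)
      difference = begin
        orbit′ f l x₁ *ᶻ (orbit′ f K y - orbit′ f K x₁)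
          ≡⟨ expand (orbit′ f l x₁) (orbit′ f K y) (orbit′ f K x₁) ⟩
        orbit′ f K y *ᶻ orbit′ f l x₁ - orbit′ f K x₁ *ᶻ orbit′ f l x₁
          ≡⟨ cong (_- orbit′ f K x₁ *ᶻ orbit′ f l x₁) commute ⟩
        orbit′ f l (orbit f K x₁) *ᶻ orbit′ f K x₁ - orbit′ f K x₁ *ᶻ orbit′ f l x₁
          ≡⟨ collect (orbit′ f l (orbit f K x₁)) (orbit′ f K x₁) (orbit′ f l x₁) ⟩
        orbit′ f K x₁ *ᶻ (orbit′ f l (orbit f K x₁) - orbit′ f l x₁) ∎
        where
        open ≡-Reasoning
        expand : ∀ u v w → u *ᶻ (v - w) ≡ v *ᶻ u - w *ᶻ u
        expand u v w = solve (u ∷ v ∷ w ∷ [])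
        collect : ∀ u v w → u *ᶻ v - v *ᶻ w ≡ v *ᶻ (u - w)
        collect u v w = solve (u ∷ v ∷ w ∷ [])
        commute : orbit′ f K y *ᶻ orbit′ f l x₁ ≡ orbit′ f l (orbit f K x₁) *ᶻ orbit′ f K x₁
        commute = trans (sym (orbit′-+ f K l x₁))
          (trans (cong (λ j → orbit′ f j x₁) (ℕₚ.+-comm K l)) (orbit′-+ f l K x₁))

    module Lifted {d : ℕ} (1<d : 1 < d)
                  (σ̃ : Cycle (suc n)) (isLift : IsLift σ σ̃) (length-σ̃ : length σ̃ ≡ k * d) where
      module σ̃ = AlongCycle σ̃

      K : ℕ
      K = k * d

      g : ℤ[X]
      g = iterate f k

      down : ∀ w → w ∈ᶜ σ̃ → w ∈ᶜ σ
      down = lift-∈ {τ = σ} {σ̃} isLift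

      -- A coincidence would make the length `k * d` of the lift divide `(j ∸ i) * k`, which is
      -- positive and smaller.
      distinct : ∀ w → w ∈ᶜ σ̃ → ∀ {i j} → i < j → j < d → ¬ P (suc n) ∣ orbit g j w - orbit g i w
      distinct w w∈ {i} {j} i<j j<d e = ℕₚ.<⇒≱ j∸i<d (ℕₚ.*-cancelʳ-≤ d (j ∸ i) k {{σ.L≢0}}
          (subst (ℕ._≤ (j ∸ i) * k) (trans length-σ̃ (ℕₚ.*-comm k d))
            (ℕ∣.∣⇒≤ {{ℕₚ.m*n≢0 (j ∸ i) k {{ℕ.>-nonZero (ℕₚ.m<n⇒0<n∸m i<j)}} {{σ.L≢0}}}}
              (σ̃.return⇒∣ v (σ̃.orbit-∈ w (i * k) w∈)
                (subst₂ (λ x y → P (suc n) ∣ x - y) forward (orbit-iterate f k i w) e)))))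
        where
        v = orbit f (i * k) w
        j∸i<d : j ∸ i < d
        j∸i<d = ℕₚ.≤-<-trans (ℕₚ.m∸n≤m j i) j<d
        forward : orbit g j w ≡ orbit f ((j ∸ i) * k) v
        forward = trans (orbit-iterate f k j w)
          (trans (cong (λ m → orbit f m w)
                   (trans (cong (ℕ._* k) (sym (ℕₚ.m∸n+n≡m (ℕₚ.<⇒≤ i<j)))) (ℕₚ.*-distribʳ-+ k (j ∸ i) i)))
            (orbit-+ f ((j ∸ i) * k) (i * k) w))

      near : ∀ w → w ∈ᶜ σ̃ → ∀ j → P n ∣ orbit g j w - w
      near w w∈ j = subst (λ v → P n ∣ v - w) (sym (orbit-iterate f k j w))
        (σ.∣⇒return w (down w w∈) (ℕ∣.n∣m*n j))

      g′-1-unit : ∀ w → w ∈ᶜ σ̃ → ¬ P 1 ∣ orbit′ f k w - 1ℤ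
      g′-1-unit w w∈ = unit-mod (orbit′ f k w - 1ℤ) (a σ - 1ℤ)
        (subst (P 1 ∣_) (shift (orbit′ f k w) (a σ))
          (P-weaken 1 n 1≤n (orbit′-constant ℕ∣.∣-refl w (down w w∈))))
        a-1-unit
        where
        shift : ∀ x y → x - y ≡ (x - 1ℤ) - (y - 1ℤ)
        shift x y = solve (x ∷ y ∷ [])

      module Near (w : ℤ) (w∈ : w ∈ᶜ σ̃) = NearPoint {n} {d} 1≤n 1<d g w
        (near w w∈) (distinct w w∈) (orbit′-unit k w (down w w∈)) (g′-1-unit w w∈)

      orbit-g : ∀ x → orbit g d x ≡ orbit f K x
      orbit-g x = trans (orbit-iterate f k d x) (cong (λ j → orbit f j x) (ℕₚ.*-comm d k))

      Returns : ℕ → ℤ → Set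
      Returns M w = P M ∣ orbit f K w - w

      Returns⇒Q : ∀ m w (w∈ : w ∈ᶜ σ̃) → Returns (n + m) w → P m ∣ Near.Q w w∈ w
      Returns⇒Q m w w∈ r = Near.return⇒Q w w∈ m (subst (λ v → P (n + m) ∣ v - w) (sym (orbit-g w)) r)

      Q⇒Returns : ∀ m w (w∈ : w ∈ᶜ σ̃) → P m ∣ Near.Q w w∈ w → Returns (n + m) w
      Q⇒Returns m w w∈ q = subst (λ v → P (n + m) ∣ v - w) (orbit-g w) (Near.Q⇒return w w∈ m q)

      -- Moving `y` along its orbit to `w`, congruent to `t` mod `p^(n+1)`, keeps the return
      -- property because iterates commute. From `w` to `t` it passes through Q, which is nearly
      -- constant there.
      Returns-spread : ∀ m → m ≤ d * n → ∀ y t → y ∈ᶜ σ̃ → t ∈ᶜ σ̃ →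
        Returns (n + m) y → Returns (n + m) t
      Returns-spread m m≤ y t y∈ t∈ r with σ̃.reach y t y∈ t∈
      ... | l , _ , e = Q⇒Returns m t t∈
        (Near.Q-nearby-∣ w w∈ m t m≤ (∣-sym w t (P-weaken n (suc n) (ℕₚ.n≤1+n n) e)) (Returns⇒Q m w w∈ r-w))
        where
        w = orbit f l y
        w∈ = σ̃.orbit-∈ y l y∈
        r-w : Returns (n + m) w
        r-w = subst (λ v → P (n + m) ∣ v - w) (orbit-comm f l K y) (orbit-mod f l (orbit f K y) y r)

      h′ : ℤ → ℤ
      h′ = orbit′ f K

      hasDerivative-h : ∀ y → HasDerivative (orbit g d) y (h′ y)
      hasDerivative-h y = hasDerivative-cong {orbit f K} (λ x → sym (orbit-g x)) (hasDerivative-orbit f K y)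

      -- Links the multiplier at the given `y` to the returns of any `t` over the lift, in
      -- particular of the base point of a descendant.
      h′⇒Returns : ∀ m → m ≤ d * n → ∀ y t → y ∈ᶜ σ̃ → t ∈ᶜ σ̃ →
        P m ∣ h′ y - 1ℤ → Returns (n + m) t
      h′⇒Returns m m≤ y t y∈ t∈ e = Returns-spread m m≤ y t y∈ t∈
        (Q⇒Returns m y y∈ (Near.h′⇒Q y y∈ (hasDerivative-h y) m m≤ e))

      Returns⇒h′ : ∀ m → m ≤ d * n → ∀ y t → y ∈ᶜ σ̃ → t ∈ᶜ σ̃ →
        Returns (n + m) t → P m ∣ h′ y - 1ℤ
      Returns⇒h′ m m≤ y t y∈ t∈ r = Near.Q⇒h′ y y∈ (hasDerivative-h y) m m≤
        (Returns⇒Q m y y∈ (Returns-spread m m≤ t y t∈ y∈ r))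

      1≤dn : 1 ≤ d * n
      1≤dn = ℕₚ.*-mono-≤ (ℕₚ.<⇒≤ 1<d) 1≤n

      Returns-σ̃ : ∀ w → w ∈ᶜ σ̃ → Returns (suc n) w
      Returns-σ̃ w w∈ = σ̃.∣⇒return w w∈ (ℕ∣.∣-reflexive length-σ̃)

      p∣h′-1 : ∀ y → y ∈ᶜ σ̃ → P 1 ∣ h′ y - 1ℤ
      p∣h′-1 y y∈ = Returns⇒h′ 1 1≤dn y y y∈ y∈
        -- Closing up at level `n + 1` is the return condition for `m = 1`.
        (subst (λ M → Returns M y) (sym (ℕₚ.+-comm n 1)) (Returns-σ̃ y y∈))

      -- Descendants of the lift

      module Below {M : ℕ} (ρ : Cycle M) (D : Descendant σ̃ ρ) where
        private
          module ρ = AlongCycle ρ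
          x = Cycle.x₁ ρ

        x∈ : x ∈ᶜ σ̃
        x∈ = descendant-∈ D x (x₁-∈ ρ)

        module _ (x-returns : Returns M x) where

          -- The return of `x` mod `p^M` makes the length divide `K`. Conversely, closing up mod
          -- `p^M` implies closing up mod `p^(n+1)`, which takes a multiple of `K` steps. Hence
          -- `a ρ` and `b ρ` are computed from h itself.
          length-ρ : length ρ ≡ K
          length-ρ = ℕ∣.∣-antisym (ρ.return⇒∣ x (x₁-∈ ρ) x-returns)
            (subst (ℕ∣._∣ length ρ) length-σ̃ (σ̃.return⇒∣ x x∈
              (P-weaken (suc n) M (descendant-≤ D) (ρ.∣⇒return x (x₁-∈ ρ) ℕ∣.∣-refl))))

          a≡1 : a ρ ≡ 1ℤ [mod p ]
          a≡1 = subst₂ _∣_ P1≡p (cong (λ j → orbit′ f j x - 1ℤ) (sym length-ρ)) (p∣h′-1 x x∈)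

          h-x : eval (iterate f (length ρ)) x - x ≡ orbit f K x - x
          h-x = cong (_- x) (trans (eval-iterate f (length ρ) x) (cong (λ j → orbit f j x) length-ρ))

          M∣ : P M ∣ eval (iterate f (length ρ)) x - x
          M∣ = subst (P M ∣_) (sym h-x) x-returns

          Returns⇒b≡0 : Returns (suc M) x → b ρ ≡ 0ℤ [mod p ]
          Returns⇒b≡0 r = subst₂ _∣_ P1≡p (sym (ℤₚ.+-identityʳ (b ρ)))
            (∣⇒p∣quotient M {{ℕₚ.m^n≢0 p M}} M∣ (subst (P (suc M) ∣_) (sym h-x) r))

          b≡0⇒Returns : b ρ ≡ 0ℤ [mod p ] → Returns (suc M) x
          b≡0⇒Returns b∣ = subst (P (suc M) ∣_) h-x
            (p∣quotient⇒∣ M {{ℕₚ.m^n≢0 p M}} M∣ (subst₂ _∣_ (sym P1≡p) (ℤₚ.+-identityʳ (b ρ)) b∣))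

      module _ {m : ℕ} (m≤ : m ≤ d * n) (y : ℤ) (y∈ : y ∈ᶜ σ̃) (m∣ : P m ∣ h′ y - 1ℤ) where

        -- The base point returns mod `p^(n+m)`, hence mod `p^M`, which fixes the length and gives
        -- `a ≡ 1`, and mod `p^(M+1)`, which gives `b ≡ 0`.
        descendant-splits : ∀ {M} (ρ : Cycle M) → Descendant σ̃ ρ → M < n + m → Splits ρ
        descendant-splits {M} ρ D M< = Below.a≡1 ρ D (weaken M (ℕₚ.<⇒≤ M<)) ,
          Below.Returns⇒b≡0 ρ D (weaken M (ℕₚ.<⇒≤ M<)) (weaken (suc M) M<)
          where
          weaken : ∀ j → j ≤ n + m → Returns j (Cycle.x₁ ρ)
          weaken j j≤ = P-weaken j (n + m) j≤ (h′⇒Returns m m≤ y _ y∈ (Below.x∈ ρ D) m∣)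

        splitsTimes : 1 ≤ m → SplitsTimes (m ∸ 1) σ̃
        splitsTimes 1≤m {M} ρ D M< = descendant-splits ρ D
          -- The lift sits at level `n + 1`, so `m - 1` splittings reach exactly the levels below
          -- `n + m`.
          (subst (M <_) (trans (sym (ℕₚ.+-suc n (m ∸ 1))) (cong (λ v → n + v) (ℕₚ.m+[n∸m]≡n 1≤m))) M<)

        -- If `b ≡ 0`, the base point would return mod `p^(n+m+1)`, forcing one more power of p into
        -- `h′ y - 1`.
        descendant-grows : suc m ≤ d * n → ¬ P (suc m) ∣ h′ y - 1ℤ →
          ∀ (ρ : Cycle (n + m)) → Descendant σ̃ ρ → Grows ρ
        descendant-grows m< ¬m∣ ρ D = Below.a≡1 ρ D x-returns , λ b∣ →
          ¬m∣ (Returns⇒h′ (suc m) m< y (Cycle.x₁ ρ) y∈ (Below.x∈ ρ D)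
            (subst (λ j → Returns j (Cycle.x₁ ρ)) (sym (ℕₚ.+-suc n m)) (Below.b≡0⇒Returns ρ D x-returns b∣)))
          where
          x-returns : Returns (n + m) (Cycle.x₁ ρ)
          x-returns = h′⇒Returns m m≤ y _ y∈ (Below.x∈ ρ D) m∣

mainTheorem6 :
  (p : ℕ) (p-prime : Prime p) → p ≢ 2 →
  (f : ℤ[X]) → let open Dynamics p p-prime f in
  (n : ℕ) → 1 ≤ n →
  (σ : Cycle n) → PartiallySplits σ →
  (d : ℕ) → IsOrderMod p (a σ) d →
  (σ̃ : Cycle (suc n)) → IsLift σ σ̃ → length σ̃ ≡ length σ * d →
  (y : ℤ) → y ∈ᶜ σ̃ →
  let h = iterate f (length σ * d)
      ord[a-1] : ℤ → ℕ ⁺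
      ord[a-1] z = ord p (eval (derivative h) z - 1ℤ)
  in
  (∀ e → ord[a-1] y ≡ [ e ] → e < n * d →
     1 ≤ e × SplitsTimes (e ∸ 1) σ̃ ×
     (∀ (ρ : Cycle (n + e)) → Descendant σ̃ ρ → Grows ρ))
  ×
  ([ n * d ] ≤⁺ ord[a-1] y → SplitsTimes (n * d ∸ 1) σ̃)
  ×
  (ord[a-1] y <⁺ [ n ] →
     ∀ (τ : Cycle (suc n)) → IsLift σ τ → length τ ≡ length σ * d →
     ∀ z → z ∈ᶜ τ → ord[a-1] z ≡ ord[a-1] y)
mainTheorem6 p p-prime _ f n 1≤n σ splits d isOrder σ̃ isLift length-σ̃ y y∈ =
  (λ e ord≡e e<nd →
    let e∣ , ¬e∣ = ord-sound (h′ y - 1ℤ) ord≡e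
        e<dn = subst (e <_) (ℕₚ.*-comm n d) e<nd
        1≤e = ℕₚ.≮⇒≥ (λ e<1 → ¬e∣ (P-weaken (suc e) 1 e<1 (p∣h′-1 y y∈)))
    in 1≤e ,
       splitsTimes (ℕₚ.<⇒≤ e<dn) y y∈ e∣ 1≤e ,
       descendant-grows (ℕₚ.<⇒≤ e<dn) y y∈ e∣ e<dn ¬e∣) ,
  (λ nd≤ord → splitsTimes (ℕₚ.≤-reflexive (ℕₚ.*-comm n d)) y y∈
    (≤ord⇒∣ (n * d) (h′ y - 1ℤ) nd≤ord) (subst (1 ≤_) (ℕₚ.*-comm d n) 1≤dn)) ,
  -- Both `y` and `z` reduce into `σ`, so `h′ y` and `h′ z` agree mod `p^n` with the value of `h′`
  -- at the base point of `σ`.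
  λ ord<n τ τ-lift _ z z∈ → ord-mod n (h′ y - 1ℤ) (h′ z - 1ℤ)
    (subst (P n ∣_) (drop-1 (h′ z) (h′ y))
      (∣-chain (h′ z) (h′ (Cycle.x₁ σ)) (h′ y)
        (orbit′-constant (ℕ∣.m∣m*n d) z (lift-∈ {τ = σ} {τ} τ-lift z z∈))
        (∣-sym (h′ y) (h′ (Cycle.x₁ σ)) (orbit′-constant (ℕ∣.m∣m*n d) y (down y y∈)))))
    ord<n
  where
  open PrimePowers p p-prime
  open Valuation p p-prime
  open Dynamics p p-prime f
  open Cycles p p-prime f
  open PartialSplitting p p-prime f
  open Base 1≤n σ splits

  d≢1 : d ≢ 1
  -- Order 1 would mean `a σ ≡ 1`, which partial splitting excludes.
  d≢1 refl = proj₂ splits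
    (subst (λ v → + p ∣ v - 1ℤ) (ℤₚ.^-identityʳ (a σ)) (IsOrderMod.power≡1 isOrder))

  1<d : 1 < d
  1<d = ℕₚ.≤∧≢⇒< (IsOrderMod.positive isOrder) (λ 1≡d → d≢1 (sym 1≡d))

  open Lifted 1<d σ̃ isLift length-σ̃

  drop-1 : ∀ u v → u - v ≡ (u - 1ℤ) - (v - 1ℤ)
  drop-1 u v = solve (u ∷ v ∷ [])
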